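{- Let $\beta\subseteq\alpha$ be compositions such that the skew diagram $\alpha/\beta$ is connected. Then the poset $\mathrm{SET}(\alpha/\beta)$ has a unique minimal element, namely the column superstandard tableau $S^{\mathrm{col}}_{\alpha/\beta}$. Equivalently, $\mathrm{SET}(\alpha/\beta)$ coincides with the interval $[S^{\mathrm{col}}_{\alpha/\beta},S^{\mathrm{row}}_{\alpha/\beta}]$ of the poset $\mathrm{SIT}(\alpha/\beta)$, and the rank of $\mathrm{SET}(\alpha/\beta)$ (the length of a longest chain) is $\binom{|\alpha/\beta|}{2}-\sum_{c\in\alpha/\beta}\mathrm{ls}(c)$.
   Context: A composition is a finite sequence $\alpha=(\alpha_1,\ldots,\alpha_k)$ of positive integers; $|\alpha|=\sum_i\alpha_i$. Its diagram has $\alpha_i$ left-justified cells in row $i$, rows numbered from the bottom (row 1 lowest). For compositions $\beta\subseteq\alpha$ (meaning $\ell(\beta)\le\ell(\alpha)$ and $\beta_j\le\alpha_j$ for $j\le\ell(\beta)$), the skew diagram $\alpha/\beta$ is the set of cells of the diagram of $\alpha$ not in that of $\beta$ (same bottom-left corner); $n=|\alpha/\beta|=|\alpha|-|\beta|$. The reduced shape of $\alpha/\beta$ is obtained by deleting rows $i$ with $\alpha_i=\beta_i$ (empty rows). $\alpha/\beta$ is connected if in its reduced shape, for every pair of consecutive rows, there is at least one column containing a cell of each row of the pair. A standard immaculate tableau of shape $\alpha/\beta$ is a bijective filling of the cells with $1,\ldots,n$ such that each row strictly increases left to right and the entries in the cells of $\alpha/\beta$ lying in the first column strictly increase bottom to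 top; $\mathrm{SIT}(\alpha/\beta)$ is the set of these. A standard extended tableau additionally has all columns strictly increasing bottom to top; $\mathrm{SET}(\alpha/\beta)\subseteq\mathrm{SIT}(\alpha/\beta)$ is the set of these. For $1\le i\le n-1$ and a tableau $T$, $\pi_i(T)=T$ if $i+1$ is in a strictly higher row than $i$; $\pi_i(T)=s_i(T)$ (swap entries $i$ and $i+1$) if $i+1$ is in a strictly lower row than $i$; $\pi_i(T)=0$ if $i,i+1$ are in the same row. These maps preserve $\mathrm{SIT}(\alpha/\beta)\cup\{0\}$ and $\mathrm{SET}(\alpha/\beta)\cup\{0\}$. Partial order on $\mathrm{SIT}(\alpha/\beta)$ (and on the subset $\mathrm{SET}(\alpha/\beta)$): $S\le T$ iff $T$ is obtained from $S$ by applying a finite sequence of operators $\pi_i$ with all intermediate results nonzero. $S^{\mathrm{row}}_{\alpha/\beta}$ is the tableau filled with $1,\ldots,n$ consecutively along rows left to right, starting with the bottom row and moving up; $S^{\mathrm{col}}_{\alpha/\beta}$ is filled with $1,\ldots,n$ consecutively along columns bottom to top, starting with the leftmost column and moving right. For a cell $c$ of $\alpha/\beta$, $\mathrm{ls}(c)$ (left shadow) is the number of cells of $\alpha/\beta$ weakly southwest of $c$, excluding $c$ itself. -}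

module Defs where

open import Data.Nat using (ℕ; zero; suc; _+_; _∸_; _<_; _≤_; _<ᵇ_; _≤ᵇ_; _≡ᵇ_)
open import Data.Bool using (Bool; true; false; if_then_else_; _∧_; _∨_; not)
open import Data.List using (List; []; _∷_; map; concat; concatMap; filterᵇ; length; upTo)
open import Data.Nat.ListAction using (sum)
open import Data.Bool.ListAction using (any)
open import Data.Maybe using (Maybe; just; nothing; fromMaybe) renaming (map to mapMaybe)
open import Data.Product using (_×_; _,_; Σ; proj₁; proj₂)
open import Data.List.Relation.Unary.All using (All)
open import Data.List.Relation.Unary.Linked using (Linked)
open import Data.List.Relation.Binary.Permutation.Propositional using (_↭_)
open import Relation.Binary.PropositionalEquality using (_≡_; _≢_)
open import Relation.Binary.Construct.Closure.ReflexiveTransitive using (Star)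

-- Compositions.  A composition is a list of positive naturals,
-- α = (α₁,…,α_k) stored as the list α₁ ∷ … ∷ α_k ∷ [].
-- Rows are indexed 0,1,… from the BOTTOM (index 0 = paper's row 1).

IsComposition : List ℕ → Set
IsComposition α = All (λ a → 0 < a) α

data _⊆c_ : List ℕ → List ℕ → Set where
  []⊆ : ∀ {α} → [] ⊆c α
  ∷⊆  : ∀ {b a β α} → b ≤ a → β ⊆c α → (b ∷ β) ⊆c (a ∷ α)

nth : {A : Set} → List A → ℕ → Maybe A
nth [] _ = nothing
nth (x ∷ xs) zero = just x
nth (x ∷ xs) (suc i) = nth xs i

part : List ℕ → ℕ → ℕ
part β i = fromMaybe 0 (nth β i)

-- Skew diagram α/β.  A cell is (row , column), row 0-based from the
-- bottom, column 1-based from the left.  Row i of α/β consists of the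
-- columns part β i + 1, …, part α i.

Cell : Set
Cell = ℕ × ℕ

rowCells : List ℕ → List ℕ → ℕ → List Cell
rowCells α β i = map (λ k → (i , suc (part β i + k))) (upTo (part α i ∸ part β i))

cells : List ℕ → List ℕ → List Cell
cells α β = concatMap (rowCells α β) (upTo (length α))

size : List ℕ → List ℕ → ℕ
size α β = sum α ∸ sum β

InRow : List ℕ → List ℕ → ℕ → ℕ → Set
InRow α β i j = part β i < j × j ≤ part α i

nonemptyRows : List ℕ → List ℕ → List ℕ
nonemptyRows α β = filterᵇ (λ i → part β i <ᵇ part α i) (upTo (length α))

Connected : List ℕ → List ℕ → Set
Connected α β =
  Linked (λ i k → Σ ℕ λ j → InRow α β i j × InRow α β k j) (nonemptyRows α β)

-- Tableaux: a list of rows (bottom row first), each row the list of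
-- entries of that row of α/β from left to right.

Tableau : Set
Tableau = List (List ℕ)

rowOfT : Tableau → ℕ → List ℕ
rowOfT T i = fromMaybe [] (nth T i)

entryAt : List ℕ → Tableau → ℕ → ℕ → Maybe ℕ
entryAt β T i j =
  if part β i <ᵇ j then nth (rowOfT T i) (j ∸ suc (part β i)) else nothing

Shaped : List ℕ → List ℕ → Tableau → Set
Shaped α β T = map length T ≡ map (λ i → part α i ∸ part β i) (upTo (length α))

ColInc : List ℕ → Tableau → ℕ → Set
ColInc β T j = ∀ i i' x y → i < i' →
  entryAt β T i j ≡ just x → entryAt β T i' j ≡ just y → x < y

IsSIT : List ℕ → List ℕ → Tableau → Set
IsSIT α β T =
  Shaped α β T ×
  (concat T ↭ map suc (upTo (size α β))) ×
  All (Linked _<_) T ×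
  ColInc β T 1

IsSET : List ℕ → List ℕ → Tableau → Set
IsSET α β T = IsSIT α β T × (∀ j → ColInc β T j)

-- The operators π_i  (nothing represents the value 0)

rowOf : ℕ → Tableau → Maybe ℕ
rowOf k [] = nothing
rowOf k (r ∷ rs) = if any (_≡ᵇ_ k) r then just 0 else mapMaybe suc (rowOf k rs)

swapVal : ℕ → ℕ → ℕ
swapVal i x = if x ≡ᵇ i then suc i else (if x ≡ᵇ suc i then i else x)

swapT : ℕ → Tableau → Tableau
swapT i T = map (map (swapVal i)) T

π : ℕ → Tableau → Maybe Tableau
π i T with rowOf i T | rowOf (suc i) T
... | just r | just r' =
  if r <ᵇ r' then just T else (if r' <ᵇ r then just (swapT i T) else nothing)
... | _ | _ = nothing

Step : ℕ → Tableau → Tableau → Set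
Step n S T = Σ ℕ λ i → 1 ≤ i × suc i ≤ n × π i S ≡ just T

_≼[_]_ : Tableau → ℕ → Tableau → Set
S ≼[ n ] T = Star (Step n) S T

tab : List ℕ → List ℕ → (Cell → ℕ) → Tableau
tab α β f = map (λ i → map f (rowCells α β i)) (upTo (length α))

countCells : List ℕ → List ℕ → (Cell → Bool) → ℕ
countCells α β p = length (filterᵇ p (cells α β))

Srow : List ℕ → List ℕ → Tableau
Srow α β = tab α β (λ c → suc (countCells α β (λ c' →
  (proj₁ c' <ᵇ proj₁ c) ∨ ((proj₁ c' ≡ᵇ proj₁ c) ∧ (proj₂ c' <ᵇ proj₂ c)))))

Scol : List ℕ → List ℕ → Tableau
Scol α β = tab α β (λ c → suc (countCells α β (λ c' →
  (proj₂ c' <ᵇ proj₂ c) ∨ ((proj₂ c' ≡ᵇ proj₂ c) ∧ (proj₁ c' <ᵇ proj₁ c)))))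

ls : List ℕ → List ℕ → Cell → ℕ
ls α β c = countCells α β (λ c' →
  (proj₁ c' ≤ᵇ proj₁ c) ∧ (proj₂ c' ≤ᵇ proj₂ c) ∧
  not ((proj₁ c' ≡ᵇ proj₁ c) ∧ (proj₂ c' ≡ᵇ proj₂ c)))

totalLs : List ℕ → List ℕ → ℕ
totalLs α β = sum (map (ls α β) (cells α β))

IsMinimalSET : List ℕ → List ℕ → Tableau → Set
IsMinimalSET α β T = IsSET α β T × (∀ S → IsSET α β S → S ≼[ size α β ] T → S ≡ T)

IsChainSET : List ℕ → List ℕ → List Tableau → Set
IsChainSET α β Ts =
  All (IsSET α β) Ts × Linked (λ S T → S ≼[ size α β ] T × S ≢ T) Ts

-- the rank (length of a longest chain, counted in covering steps) is r
HasRankSET : List ℕ → List ℕ → ℕ → Set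
HasRankSET α β r =
  (Σ (List Tableau) λ Ts → IsChainSET α β Ts × length Ts ≡ suc r) ×
  (∀ Ts → IsChainSET α β Ts → length Ts ≤ suc r)

{-# OPTIONS --safe #-}

-- Connectedness forces the entries of a standard extended tableau to increase along every weakly
-- southwest relation between cells, so SET(α/β) consists of the linear extensions of that partial
-- order.  A swap made by π_i lowers by exactly one the number of inversions (pairs of cells in which
-- the strictly higher one has the smaller entry).  A linear extension that is not in row (column)
-- reading order has consecutive entries i, i+1 out of that order; their cells are incomparable, so
-- exchanging them is a move up (down) inside SET(α/β).  Hence S^row is reached from below and S^col
-- from above, and a longest chain has as many steps as S^col has inversions.  These are the pairs
-- (c,d) with c strictly lower and strictly right of d: all pairs of cells but those counted by ls.
module Submission where

open import Defs
open import Algebra.Properties.CommutativeSemigroup using (interchange)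
open import Data.Bool using (Bool; true; false; if_then_else_)
open import Data.Bool.ListAction using (any)
open import Data.List using (List; []; _∷_; _++_; [_]; map; concat; filterᵇ; length; upTo; applyUpTo)
open import Data.List.Membership.Propositional using (_∈_; _∉_; lose; find)
open import Data.List.Membership.Propositional.Properties
  using (∈-∃++; ∈-map⁺; ∈-map⁻; ∈-upTo⁺; ∈-upTo⁻; ∈-applyUpTo⁺; ∈-concatMap⁺; ∈-concatMap⁻; ∈-filter⁺)
open import Data.List.Properties
  using ( ∷-injectiveˡ; ∷-injectiveʳ; concat-map; length-++; length-map; length-upTo; map-cong; map-cong-local
        ; map-id; map-upTo; map-∘; upTo-∷ʳ)
open import Data.List.Relation.Binary.Permutation.Propositional
  using (_↭_; ↭-refl; ↭-sym; ↭-trans; prep; ↭⇒↭ₛ)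
open import Data.List.Relation.Binary.Permutation.Propositional.Properties
  using (∈-resp-↭; shift; ↭-length) renaming (map⁺ to ↭-map⁺)
import Data.List.Relation.Binary.Permutation.Setoid.Properties as ↭ₛ
open import Data.List.Relation.Unary.All as All using (All; []; _∷_)
import Data.List.Relation.Unary.All.Properties as All
open import Data.List.Relation.Unary.AllPairs using (AllPairs; []; _∷_)
import Data.List.Relation.Unary.AllPairs.Properties as AllPairs
open import Data.List.Relation.Unary.Any using (here; there)
open import Data.List.Relation.Unary.Linked using (Linked; [-]; _∷_)
import Data.List.Relation.Unary.Linked.Properties as Linked
open import Data.List.Relation.Unary.Unique.Propositional using (Unique)
import Data.List.Relation.Unary.Unique.Propositional.Properties as Unique
open import Data.Maybe using (just; nothing; fromMaybe)
open import Data.Maybe.Properties using (just-injective)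
open import Data.Nat
open import Data.Nat.Combinatorics using (_C_; nC1≡n; nCk+nC[k+1]≡[n+1]C[k+1])
open import Data.Nat.ListAction using (sum)
open import Data.Nat.ListAction.Properties using (sum-↭; sum-++)
open import Data.Nat.Properties
open import Data.Product using (Σ; _×_; _,_; proj₁; proj₂; ∃-syntax)
open import Data.Product.Properties using (≡-dec)
open import Data.Sum as Sum using (_⊎_; inj₁; inj₂)
open import Function using (_∘_; id)
open import Function.Bundles using (_⇔_; mk⇔)
open import Relation.Binary.Construct.Closure.ReflexiveTransitive using (ε; _◅_; _◅◅_)
open import Relation.Binary.Definitions using (tri<; tri≈; tri>)
open import Relation.Binary.PropositionalEquality hiding ([_])
open import Relation.Nullary using (¬_; Dec; yes; no; does; contradiction)
open import Relation.Nullary.Decidable using (dec-true; dec-false; T?; _×-dec_; _⊎-dec_; ¬?)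

private variable
  A B : Set
  P Q R : Set

-- Indicators and finite sums

+-interchange : ∀ a b c d → (a + b) + (c + d) ≡ (a + c) + (b + d)
+-interchange = interchange +-commutativeSemigroup

χ : Dec P → ℕ
χ d = if does d then 1 else 0

χ-yes : (d : Dec P) → P → χ d ≡ 1
χ-yes d p rewrite dec-true d p = refl

χ-no : (d : Dec P) → ¬ P → χ d ≡ 0
χ-no d ¬p rewrite dec-false d ¬p = refl

χ-mono : (d : Dec P) (e : Dec Q) → (P → Q) → χ d ≤ χ e
χ-mono (yes p) e P⇒Q = ≤-reflexive (sym (χ-yes e (P⇒Q p)))
χ-mono (no _)  e P⇒Q = z≤n

χ-cong : (d : Dec P) (e : Dec Q) → (P → Q) → (Q → P) → χ d ≡ χ e
χ-cong d e P⇒Q Q⇒P = ≤-antisym (χ-mono d e P⇒Q) (χ-mono e d Q⇒P)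

χ-⊎ : (d : Dec P) (e : Dec Q) (g : Dec R) → (P → Q ⊎ R) → (Q → P) → (R → P) → (Q → ¬ R) →
  χ d ≡ χ e + χ g
χ-⊎ d (yes q) g f i j x rewrite χ-yes d (i q) | χ-no g (x q) = refl
χ-⊎ d (no ¬q) (yes r) f i j x = χ-yes d (j r)
χ-⊎ d (no ¬q) (no ¬r) f i j x = χ-no d λ p → Sum.[ ¬q , ¬r ] (f p)

sum-cong : ∀ {g h : A → ℕ} xs → (∀ {x} → x ∈ xs → g x ≡ h x) → sum (map g xs) ≡ sum (map h xs)
sum-cong []       eq = refl
sum-cong (x ∷ xs) eq = cong₂ _+_ (eq (here refl)) (sum-cong xs (eq ∘ there))

sum-mono : ∀ {g h : A → ℕ} xs → (∀ {x} → x ∈ xs → g x ≤ h x) → sum (map g xs) ≤ sum (map h xs)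
sum-mono []       le = z≤n
sum-mono (x ∷ xs) le = +-mono-≤ (le (here refl)) (sum-mono xs (le ∘ there))

sum-mono-< : ∀ {g h : A → ℕ} {y} xs → (∀ {x} → x ∈ xs → g x ≤ h x) → y ∈ xs → g y < h y →
  sum (map g xs) < sum (map h xs)
sum-mono-< (x ∷ xs) le (here refl) lt = +-mono-<-≤ lt (sum-mono xs (le ∘ there))
sum-mono-< (x ∷ xs) le (there y∈)  lt = +-mono-≤-< (le (here refl)) (sum-mono-< xs (le ∘ there) y∈ lt)

sum-map-+ : ∀ (g h : A → ℕ) xs → sum (map (λ x → g x + h x) xs) ≡ sum (map g xs) + sum (map h xs)
sum-map-+ g h []       = refl
sum-map-+ g h (x ∷ xs) rewrite sum-map-+ g h xs = +-interchange (g x) (h x) _ _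

sum-zero : ∀ {g : A → ℕ} xs → (∀ {x} → x ∈ xs → g x ≡ 0) → sum (map g xs) ≡ 0
sum-zero []       eq = refl
sum-zero (x ∷ xs) eq rewrite eq (here refl) = sum-zero xs (eq ∘ there)

-- Used on the outer and then on the inner sum of `inv`, it isolates the one pair of cells whose
-- status a swap changes.
sum-suc-at : ∀ {g h : A → ℕ} {y xs} → Unique xs → y ∈ xs → g y ≡ suc (h y) →
  (∀ {x} → x ∈ xs → x ≢ y → g x ≡ h x) → sum (map g xs) ≡ suc (sum (map h xs))
sum-suc-at {xs = x ∷ xs} (x∉ ∷ _) (here refl) at off =
  cong₂ _+_ at (sum-cong xs λ z∈ → off (there z∈) (≢-sym (All.lookup x∉ z∈)))
sum-suc-at {h = h} {xs = x ∷ xs} (x∉ ∷ u) (there y∈) at off =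
  trans (cong₂ _+_ (off (here refl) (All.lookup x∉ y∈)) (sum-suc-at u y∈ at (off ∘ there)))
        (+-suc (h x) _)

length-filterᵇ : ∀ (p : A → Bool) xs → length (filterᵇ p xs) ≡ sum (map (λ x → if p x then 1 else 0) xs)
length-filterᵇ p []       = refl
length-filterᵇ p (x ∷ xs) with p x
... | true  = cong suc (length-filterᵇ p xs)
... | false = length-filterᵇ p xs

sum-upTo : ∀ n → sum (upTo n) ≡ n C 2
sum-upTo zero    = refl
sum-upTo (suc n) = begin
  sum (upTo (suc n))       ≡⟨ cong sum (sym (upTo-∷ʳ n)) ⟩
  sum (upTo n ++ [ n ])    ≡⟨ sum-++ (upTo n) [ n ] ⟩
  sum (upTo n) + (n + 0)   ≡⟨ cong₂ _+_ (sum-upTo n) (trans (+-identityʳ n) (sym (nC1≡n n))) ⟩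
  n C 2 + n C 1            ≡⟨ +-comm (n C 2) _ ⟩
  n C 1 + n C 2            ≡⟨ nCk+nC[k+1]≡[n+1]C[k+1] n 1 ⟩
  suc n C 2                ∎
  where open ≡-Reasoning

sum-applyUpTo-< : ∀ n {k} → k ≤ n → ∀ (g : ℕ → ℕ) →
  (∀ {i} → i < k → g i ≡ 1) → (∀ {i} → k ≤ i → g i ≡ 0) →
  sum (applyUpTo g n) ≡ k
sum-applyUpTo-< zero    z≤n g one nil = refl
sum-applyUpTo-< (suc n) {zero} _ g one nil
  rewrite nil {0} z≤n = sum-applyUpTo-< n z≤n (g ∘ suc) (λ ()) (λ _ → nil z≤n)
sum-applyUpTo-< (suc n) {suc k} (s≤s k≤n) g one nil
  rewrite one {0} (s≤s z≤n) = cong suc (sum-applyUpTo-< n k≤n (g ∘ suc) (one ∘ s≤s) (nil ∘ s≤s))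

-- Lists without repetitions

unique-⊆⇒↭ : ∀ {xs ys : List A} → Unique xs → (∀ {x} → x ∈ xs → x ∈ ys) → length ys ≤ length xs → xs ↭ ys
unique-⊆⇒↭ {xs = []} {[]} _ _ _ = ↭-refl
unique-⊆⇒↭ {xs = x ∷ xs} {ys} (x∉ ∷ u) sub len
  with as , bs , refl ← ∈-∃++ (sub (here refl)) =
  ↭-trans (prep x (unique-⊆⇒↭ u sub′ (s≤s⁻¹ (≤-trans (≤-reflexive (sym (↭-length σ))) len)))) (↭-sym σ)
  where
  σ = shift x as bs
  sub′ : ∀ {y} → y ∈ xs → y ∈ as ++ bs
  sub′ y∈ with ∈-resp-↭ σ (sub (there y∈))
  ... | here refl = contradiction refl (All.lookup x∉ y∈)
  ... | there y∈′ = y∈′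

map-injective-on : ∀ {f : A → B} {xs x y} → Unique (map f xs) → x ∈ xs → y ∈ xs → f x ≡ f y → x ≡ y
map-injective-on (_ ∷ _) (here refl) (here refl) eq = refl
map-injective-on {f = f} (p ∷ _) (here refl) (there y∈) eq = contradiction eq (All.lookup p (∈-map⁺ f y∈))
map-injective-on {f = f} (p ∷ _) (there x∈) (here refl) eq = contradiction (sym eq) (All.lookup p (∈-map⁺ f x∈))
map-injective-on (_ ∷ u) (there x∈) (there y∈) eq = map-injective-on u x∈ y∈ eq

map-unique-on : ∀ {f : A → B} {xs} → Unique xs → (∀ {x y} → x ∈ xs → y ∈ xs → f x ≡ f y → x ≡ y) →
  Unique (map f xs)
map-unique-on []       inj = []
map-unique-on {f = f} {x ∷ xs} (x∉ ∷ u) inj =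
  All.tabulate (λ m eq → let z , z∈ , e = ∈-map⁻ f m in
    All.lookup x∉ z∈ (inj (here refl) (there z∈) (trans eq e)))
  ∷ map-unique-on u (λ a b → inj (there a) (there b))

map-≡⇒on : ∀ {f g : A → B} {xs x} → map f xs ≡ map g xs → x ∈ xs → f x ≡ g x
map-≡⇒on eq (here refl) = ∷-injectiveˡ eq
map-≡⇒on eq (there x∈)  = map-≡⇒on (∷-injectiveʳ eq) x∈

-- Propagating an invariant along a linked list

linked-propagate-head : ∀ {R : A → A → Set} {_≺_ : A → A → Set} {J : A → Set} {u w xs} →
  (∀ {u w} → u ≺ w → R u w → J u → J w) → Linked R (u ∷ xs) → AllPairs _≺_ (u ∷ xs) →
  w ∈ u ∷ xs → J u → J w
linked-propagate-head step _       _             (here refl) j = j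
linked-propagate-head step (r ∷ l) ((lt ∷ _) ∷ s) (there w∈) j =
  linked-propagate-head step l s w∈ (step lt r j)

-- `Connected` relates only neighbours in the list of nonempty rows; this carries a property of one
-- row to any later one. In a sorted list, `¬ (w ≺ u)` says that `w` does not come before `u`.
linked-propagate : ∀ {R : A → A → Set} {_≺_ : A → A → Set} {J : A → Set} {xs} →
  (∀ {u w} → u ≺ w → R u w → J u → J w) → Linked R xs → AllPairs _≺_ xs →
  ∀ {u w} → u ∈ xs → w ∈ xs → ¬ (w ≺ u) → J u → J w
linked-propagate step l s (here refl) w∈ _ j = linked-propagate-head step l s w∈ j
linked-propagate step l (p ∷ _) (there u∈) (here refl) ¬w≺u j = contradiction (All.lookup p u∈) ¬w≺u
linked-propagate step (r ∷ l) (_ ∷ s) (there u∈) (there w∈) ¬w≺u j = linked-propagate step l s u∈ w∈ ¬w≺u j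

-- Lookup in lists and in rows

nth-applyUpTo : ∀ (f : ℕ → A) {n k} → k < n → nth (applyUpTo f n) k ≡ just (f k)
nth-applyUpTo f {suc n} {zero}  _         = refl
nth-applyUpTo f {suc n} {suc k} (s≤s k<n) = nth-applyUpTo (f ∘ suc) k<n

nth-applyUpTo-≥ : ∀ (f : ℕ → A) {n k} → n ≤ k → nth (applyUpTo f n) k ≡ nothing
nth-applyUpTo-≥ f {zero}          _         = refl
nth-applyUpTo-≥ f {suc n} {suc k} (s≤s n≤k) = nth-applyUpTo-≥ (f ∘ suc) n≤k

applyUpTo-nth : ∀ (d : A) xs → applyUpTo (λ k → fromMaybe d (nth xs k)) (length xs) ≡ xs
applyUpTo-nth d []       = refl
applyUpTo-nth d (x ∷ xs) = cong (x ∷_) (applyUpTo-nth d xs)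

applyUpTo-cong : ∀ {f g : ℕ → A} n → (∀ {k} → k < n → f k ≡ g k) → applyUpTo f n ≡ applyUpTo g n
applyUpTo-cong zero    eq = refl
applyUpTo-cong (suc n) eq = cong₂ _∷_ (eq (s≤s z≤n)) (applyUpTo-cong n (eq ∘ s≤s))

any-∈ : ∀ {k xs} → k ∈ xs → any (_≡ᵇ_ k) xs ≡ true
any-∈ {k} (here refl) rewrite dec-true (k ≟ k) refl = refl
any-∈ {k} {x ∷ _} (there k∈) with k ≡ᵇ x
... | true  = refl
... | false = any-∈ k∈

any-∉ : ∀ {k} xs → k ∉ xs → any (_≡ᵇ_ k) xs ≡ false
any-∉ []       k∉ = refl
any-∉ {k} (x ∷ xs) k∉ rewrite dec-false (k ≟ x) (k∉ ∘ here) = any-∉ xs (k∉ ∘ there)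

rowOf-applyUpTo : ∀ {k r} n (h : ℕ → List ℕ) → r < n → k ∈ h r → (∀ {i} → i < r → k ∉ h i) →
  rowOf k (applyUpTo h n) ≡ just r
rowOf-applyUpTo {r = zero}  (suc n) h _ k∈ k∉ rewrite any-∈ k∈ = refl
rowOf-applyUpTo {r = suc r} (suc n) h (s≤s r<n) k∈ k∉
  rewrite any-∉ (h 0) (k∉ (s≤s z≤n)) | rowOf-applyUpTo n (h ∘ suc) r<n k∈ (k∉ ∘ s≤s) = refl

-- Adjacent transpositions of values

swapVal-fst : ∀ i → swapVal i i ≡ suc i
swapVal-fst i rewrite dec-true (i ≟ i) refl = refl

swapVal-snd : ∀ i → swapVal i (suc i) ≡ i
swapVal-snd i rewrite dec-false (suc i ≟ i) 1+n≢n | dec-true (i ≟ i) refl = refl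

swapVal-else : ∀ {i x} → x ≢ i → x ≢ suc i → swapVal i x ≡ x
swapVal-else {i} {x} p q rewrite dec-false (x ≟ i) p | dec-false (x ≟ suc i) q = refl

swapVal-involutive : ∀ i x → swapVal i (swapVal i x) ≡ x
swapVal-involutive i x with x ≟ i | x ≟ suc i
... | yes refl | _        = trans (cong (swapVal i) (swapVal-fst i)) (swapVal-snd i)
... | no _     | yes refl = trans (cong (swapVal i) (swapVal-snd i)) (swapVal-fst i)
... | no p     | no q     = trans (cong (swapVal i) (swapVal-else p q)) (swapVal-else p q)

swapVal-range : ∀ {i n x} → 1 ≤ i → i < n → 1 ≤ x × x ≤ n → 1 ≤ swapVal i x × swapVal i x ≤ n
swapVal-range {i} {n} {x} 1≤i i<n b with x ≟ i | x ≟ suc i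
... | yes refl | _        rewrite swapVal-fst i = s≤s z≤n , i<n
... | no _     | yes refl rewrite swapVal-snd i = 1≤i , <⇒≤ i<n
... | no p     | no q     rewrite swapVal-else p q = b

-- No value lies strictly between `i` and `suc i`, so a third value compares in the same way with
-- both.
swapVal-mono-< : ∀ {i x y} → x < y → ¬ (x ≡ i × y ≡ suc i) → swapVal i x < swapVal i y
swapVal-mono-< {i} {x} {y} x<y ¬adj with x ≟ i | x ≟ suc i | y ≟ i | y ≟ suc i
... | yes refl | _ | yes refl | _ = contradiction x<y (<-irrefl refl)
... | yes refl | _ | no _ | yes refl = contradiction (refl , refl) ¬adj
... | yes refl | _ | no p | no q rewrite swapVal-fst i | swapVal-else p q = ≤∧≢⇒< x<y (≢-sym q)
... | no _ | yes refl | yes refl | _ = contradiction x<y (<-asym (n<1+n i))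
... | no _ | yes refl | no _ | yes refl = contradiction x<y (<-irrefl refl)
... | no _ | yes refl | no p | no q rewrite swapVal-snd i | swapVal-else p q = <-trans (n<1+n i) x<y
... | no p | no q | yes refl | _ rewrite swapVal-else p q | swapVal-fst i = m<n⇒m<1+n x<y
... | no p | no q | no _ | yes refl rewrite swapVal-else p q | swapVal-snd i = ≤∧≢⇒< (s≤s⁻¹ x<y) p
... | no p | no q | no r | no s rewrite swapVal-else p q | swapVal-else r s = x<y

-- Row lengths

part-outside : ∀ α {i} → length α ≤ i → part α i ≡ 0
part-outside []      _             = refl
part-outside (_ ∷ α) {suc i} (s≤s le) = part-outside α le

length-concat : ∀ (xss : List (List A)) → length (concat xss) ≡ sum (map length xss)
length-concat []         = refl
length-concat (xs ∷ xss) = trans (length-++ xs) (cong (length xs +_) (length-concat xss))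

-- Containment makes every truncated difference exact. With `sum β` added on the left, the induction
-- needs no subtraction of sums.
sum-parts : ∀ {α β} → β ⊆c α → sum (applyUpTo (λ i → part α i ∸ part β i) (length α)) + sum β ≡ sum α
sum-parts ([]⊆ {α}) = trans (+-identityʳ _) (cong sum (applyUpTo-nth 0 α))
sum-parts (∷⊆ {b} {a} {β} {α} b≤a β⊆α) = trans (+-interchange (a ∸ b) _ b (sum β))
  (cong₂ _+_ (m∸n+n≡m b≤a) (sum-parts β⊆α))

length-nth : ∀ (xss : List (List A)) i → length (fromMaybe [] (nth xss i)) ≡ fromMaybe 0 (nth (map length xss) i)
length-nth []        i       = refl
length-nth (_ ∷ _)   zero    = refl
length-nth (_ ∷ xss) (suc i) = length-nth xss i

allPairs-applyUpTo⁻ : ∀ {R : A → A → Set} f n → AllPairs R (applyUpTo f n) →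
  ∀ {i j} → i < j → j < n → R (f i) (f j)
allPairs-applyUpTo⁻ f (suc n) (p ∷ _) {zero}  {suc j} _         (s≤s j<n) = All.lookup p (∈-applyUpTo⁺ (f ∘ suc) j<n)
allPairs-applyUpTo⁻ f (suc n) (_ ∷ s) {suc i} {suc j} (s≤s i<j) (s≤s j<n) = allPairs-applyUpTo⁻ (f ∘ suc) n s i<j j<n

-- Cells and the weakly southwest order

row col : Cell → ℕ
row = proj₁
col = proj₂

-- `ls α β d` counts the cells `c` of the diagram with `c ⊏ d`.
_⊏_ : Cell → Cell → Set
c ⊏ d = row c ≤ row d × col c ≤ col d × c ≢ d

module Diagram (α β : List ℕ) (β⊆α : β ⊆c α) where

  D : List Cell
  D = cells α β

  n : ℕ
  n = size α β

  InRow⇒<length : ∀ {i j} → InRow α β i j → i < length α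
  InRow⇒<length {i} (b<j , j≤a) = ≰⇒> λ le →
    n≮0 (≤-trans b<j (≤-trans j≤a (≤-trans (≤-reflexive (part-outside α le)) z≤n)))

  offset-< : ∀ {i j} → InRow α β i j → j ∸ suc (part β i) < part α i ∸ part β i
  offset-< {i} {j} (b<j , j≤a) = ≤-trans (≤-reflexive (sym (+-∸-assoc 1 b<j))) (∸-monoˡ-≤ (part β i) j≤a)

  offset-+ : ∀ {i j} → InRow α β i j → suc (part β i + (j ∸ suc (part β i))) ≡ j
  offset-+ (b<j , _) = m+[n∸m]≡n b<j

  offset-∸ : ∀ i k → suc (part β i + k) ∸ suc (part β i) ≡ k
  offset-∸ i k = m+n∸m≡n (part β i) k

  offset-InRow : ∀ {i k} → k < part α i ∸ part β i → InRow α β i (suc (part β i + k))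
  offset-InRow {i} {k} k< = s≤s (m≤m+n _ k) , (begin
    suc (part β i + k)                     ≡⟨ +-suc (part β i) k ⟨
    part β i + suc k                       ≤⟨ +-monoʳ-≤ (part β i) k< ⟩
    part β i + (part α i ∸ part β i)       ≡⟨ m+[n∸m]≡n β<α ⟩
    part α i                               ∎)
    where
    open ≤-Reasoning
    -- A truncated difference that exceeds `k` is positive.
    β<α : part β i ≤ part α i
    β<α = <⇒≤ (m∸n≢0⇒n<m (λ e → n≮0 (subst (k <_) e k<)))

  ∈-rowCells⁻ : ∀ {i c} → c ∈ rowCells α β i → row c ≡ i × InRow α β i (col c)
  ∈-rowCells⁻ c∈ with k , k∈ , refl ← ∈-map⁻ _ c∈ = refl , offset-InRow (∈-upTo⁻ k∈)

  ∈-rowCells⁺ : ∀ {i j} → InRow α β i j → (i , j) ∈ rowCells α β i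
  ∈-rowCells⁺ {i} p = subst (λ j → (i , j) ∈ rowCells α β i) (offset-+ p) (∈-map⁺ _ (∈-upTo⁺ (offset-< p)))

  ∈-cells⁺ : ∀ {i j} → InRow α β i j → (i , j) ∈ D
  ∈-cells⁺ p = ∈-concatMap⁺ (rowCells α β) (lose (∈-upTo⁺ (InRow⇒<length p)) (∈-rowCells⁺ p))

  ∈-cells⁻ : ∀ {c} → c ∈ D → InRow α β (row c) (col c)
  ∈-cells⁻ c∈ with i , _ , c∈′ ← find (∈-concatMap⁻ (rowCells α β) {xs = upTo (length α)} c∈)
    with refl , p ← ∈-rowCells⁻ {i} c∈′ = p

  cells-unique : Unique D
  cells-unique = Unique.concat⁺
    (All.map⁺ {xs = upTo (length α)} (All.universal row-unique _))
    (AllPairs.map⁺ (AllPairs.applyUpTo⁺₁ id (length α) λ i<j _ (p , q) →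
      <⇒≢ i<j (trans (sym (proj₁ (∈-rowCells⁻ p))) (proj₁ (∈-rowCells⁻ q)))))
    where
    row-unique : ∀ i → Unique (rowCells α β i)
    row-unique i = Unique.map⁺ (λ e → +-cancelˡ-≡ (part β i) _ _ (suc-injective (cong proj₂ e)))
      (Unique.upTo⁺ (part α i ∸ part β i))

  length-rowCells : ∀ i → length (rowCells α β i) ≡ part α i ∸ part β i
  length-rowCells i = trans (length-map _ (upTo (part α i ∸ part β i))) (length-upTo _)

  length-cells : length D ≡ n
  length-cells = begin
    length D                                   ≡⟨ length-concat (map (rowCells α β) (upTo (length α))) ⟩
    sum (map length (map (rowCells α β) (upTo (length α)))) ≡⟨ cong sum (sym (map-∘ (upTo (length α)))) ⟩
    sum (map (length ∘ rowCells α β) (upTo (length α)))     ≡⟨ cong sum (map-cong length-rowCells (upTo (length α))) ⟩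
    sum (map (λ i → part α i ∸ part β i) (upTo (length α))) ≡⟨ cong sum (map-upTo _ (length α)) ⟩
    s                                          ≡⟨ sym (m+n∸n≡m s (sum β)) ⟩
    s + sum β ∸ sum β                          ≡⟨ cong (_∸ sum β) (sum-parts β⊆α) ⟩
    n ∎
    where
    open ≡-Reasoning
    s = sum (applyUpTo (λ i → part α i ∸ part β i) (length α))

  -- Bijective fillings and linear extensions

  Bijective : (Cell → ℕ) → Set
  Bijective f = map f D ↭ map suc (upTo n)

  module _ {f : Cell → ℕ} (p : Bijective f) where

    bij-range : ∀ {c} → c ∈ D → 1 ≤ f c × f c ≤ n
    bij-range c∈ with k , k∈ , eq ← ∈-map⁻ suc (∈-resp-↭ p (∈-map⁺ f c∈)) rewrite eq = s≤s z≤n , ∈-upTo⁻ k∈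

    bij-injective : ∀ {c d} → c ∈ D → d ∈ D → f c ≡ f d → c ≡ d
    bij-injective = map-injective-on
      (↭ₛ.Unique-resp-↭ (setoid ℕ) (↭⇒↭ₛ (↭-sym p)) (Unique.map⁺ suc-injective (Unique.upTo⁺ n)))

    bij-surjective : ∀ {k} → 1 ≤ k → k ≤ n → ∃[ c ] c ∈ D × f c ≡ k
    bij-surjective {suc k} _ k<n with c , c∈ , eq ← ∈-map⁻ f (∈-resp-↭ (↭-sym p) (∈-map⁺ suc (∈-upTo⁺ k<n))) =
      c , c∈ , sym eq

    sum-bij : ∀ (g : ℕ → ℕ) → sum (map (g ∘ f) D) ≡ sum (map (g ∘ suc) (upTo n))
    sum-bij g = trans (cong sum (map-∘ D)) (trans (sum-↭ (↭-map⁺ g p)) (cong sum (sym (map-∘ (upTo n)))))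

    -- The values are 1, ..., `n`, each taken once, so exactly `f c ∸ 1` of them lie below `f c`.
    -- This puts `f` in the counting form in which `position` is defined.
    bij-count : ∀ {c} → c ∈ D → suc (sum (map (λ c′ → χ (f c′ <? f c)) D)) ≡ f c
    bij-count {c} c∈ with f c | bij-range c∈
    ... | suc k | _ , k<n = cong suc (trans (sum-bij (λ x → χ (x <? suc k))) (trans
      (cong sum (map-upTo _ n))
      (sum-applyUpTo-< n (<⇒≤ k<n) _ (λ i<k → χ-yes (_ <? suc k) (s≤s i<k))
        (λ {i} k≤i → χ-no (suc i <? suc k) (≤⇒≯ k≤i ∘ s≤s⁻¹)))))

  -- Pigeonhole: by `length-cells` there are as many cells as values.
  bij-intro : ∀ {f} → (∀ {c d} → c ∈ D → d ∈ D → f c ≡ f d → c ≡ d) →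
    (∀ {c} → c ∈ D → 1 ≤ f c × f c ≤ n) → Bijective f
  bij-intro {f} inj range = unique-⊆⇒↭ (map-unique-on cells-unique inj) sub
    (≤-reflexive (trans (length-map suc (upTo n)) (trans (length-upTo n) (trans (sym length-cells) (sym (length-map f D))))))
    where
    sub : ∀ {x} → x ∈ map f D → x ∈ map suc (upTo n)
    sub x∈ with c , c∈ , refl ← ∈-map⁻ f x∈ with f c | range c∈
    ... | suc k | _ , k<n = ∈-map⁺ suc (∈-upTo⁺ k<n)

  record LinearExtension (f : Cell → ℕ) : Set where
    field
      bij  : Bijective f
      mono : ∀ {c d} → c ∈ D → d ∈ D → c ⊏ d → f c < f d

  open LinearExtension

  swap-injective : ∀ {f} i → Bijective f → ∀ {c d} → c ∈ D → d ∈ D → swapVal i (f c) ≡ swapVal i (f d) → c ≡ d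
  swap-injective i p c∈ d∈ eq = bij-injective p c∈ d∈
    (trans (sym (swapVal-involutive i _)) (trans (cong (swapVal i) eq) (swapVal-involutive i _)))

  -- Only the comparison between `a` and `b` is reversed. It is not imposed by the order, because
  -- `a ⊏ b` is excluded.
  swap-linearExtension : ∀ {f a b i} → LinearExtension f → a ∈ D → b ∈ D → f a ≡ i → f b ≡ suc i →
    ¬ (a ⊏ b) → LinearExtension (swapVal i ∘ f)
  swap-linearExtension {i = i} L a∈ b∈ fa fb ¬a⊏b .bij = bij-intro (swap-injective i (bij L))
    λ c∈ → swapVal-range (subst (1 ≤_) fa (proj₁ (bij-range (bij L) a∈)))
                         (subst (_≤ n) fb (proj₂ (bij-range (bij L) b∈))) (bij-range (bij L) c∈)
  swap-linearExtension L a∈ b∈ fa fb ¬a⊏b .mono c∈ d∈ c⊏d = swapVal-mono-< (mono L c∈ d∈ c⊏d) λ (fc , fd) →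
    ¬a⊏b (subst₂ _⊏_ (bij-injective (bij L) c∈ a∈ (trans fc (sym fa)))
                     (bij-injective (bij L) d∈ b∈ (trans fd (sym fb))) c⊏d)

  record ReadingOrder : Set₁ where
    field
      _◁_      : Cell → Cell → Set
      _◁?_     : ∀ c d → Dec (c ◁ d)
      ◁-irrefl : ∀ {c} → ¬ (c ◁ c)
      ◁-trans  : ∀ {c d e} → c ◁ d → d ◁ e → c ◁ e
      ◁-total  : ∀ {c d} → c ≢ d → c ◁ d ⊎ d ◁ c
      ⊏⇒◁      : ∀ {c d} → c ⊏ d → c ◁ d

    position : Cell → ℕ
    position c = suc (countCells α β (λ c′ → does (c′ ◁? c)))

    position-sum : ∀ c → position c ≡ suc (sum (map (λ c′ → χ (c′ ◁? c)) D))
    position-sum c = cong suc (length-filterᵇ _ D)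

    position-< : ∀ {c d} → c ∈ D → c ◁ d → position c < position d
    position-< {c} {d} c∈ c◁d rewrite position-sum c | position-sum d = s≤s (sum-mono-< D
      (λ {e} _ → χ-mono (e ◁? c) (e ◁? d) (λ e◁c → ◁-trans e◁c c◁d)) c∈
      (≤-reflexive (trans (cong suc (χ-no (c ◁? c) ◁-irrefl)) (sym (χ-yes (c ◁? d) c◁d)))))

    position-injective : ∀ {c d} → c ∈ D → d ∈ D → position c ≡ position d → c ≡ d
    position-injective {c} {d} c∈ d∈ eq with ≡-dec _≟_ _≟_ c d
    ... | yes c≡d = c≡d
    ... | no c≢d with ◁-total c≢d
    ... | inj₁ lt = contradiction eq (<⇒≢ (position-< c∈ lt))
    ... | inj₂ lt = contradiction (sym eq) (<⇒≢ (position-< d∈ lt))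

    position-≤ : ∀ {c} → c ∈ D → position c ≤ n
    position-≤ {c} c∈ rewrite position-sum c = ≤-trans
      -- Every indicator is at most 1, and the one of `c` itself is 0. The decision `yes c∈` stands
      -- for the constant 1.
      (sum-mono-< {h = λ _ → 1} D (λ {e} _ → χ-mono (e ◁? c) (yes c∈) (λ _ → c∈)) c∈
        (≤-reflexive (cong suc (χ-no (c ◁? c) ◁-irrefl))))
      (≤-reflexive (trans (ones D) length-cells))
      where
      ones : ∀ (xs : List Cell) → sum (map (λ _ → 1) xs) ≡ length xs
      ones []       = refl
      ones (_ ∷ xs) = cong suc (ones xs)

    position-linearExtension : LinearExtension position
    position-linearExtension .bij = bij-intro position-injective λ c∈ → s≤s z≤n , position-≤ c∈
    position-linearExtension .mono c∈ _ c⊏d = position-< c∈ (⊏⇒◁ c⊏d)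

    -- Consecutive values placed against the order; exchanging them brings the filling closer to
    -- `position`.
    Descent : (Cell → ℕ) → Set
    Descent f = ∃[ a ] ∃[ b ] a ∈ D × b ∈ D × f b ≡ suc (f a) × b ◁ a

    SortedUpTo : (Cell → ℕ) → ℕ → Set
    SortedUpTo f m = ∀ {c d} → c ∈ D → d ∈ D → f c < f d → f d ≤ m → c ◁ d

    -- Induction on `m`. Once the values up to `m` are in order, only the cells of `m` and `suc m`
    -- have to be compared; transitivity through the cell of `m` gives the rest.
    descent-or-sortedUpTo : ∀ {f} → Bijective f → ∀ m → m ≤ n → Descent f ⊎ SortedUpTo f m
    descent-or-sortedUpTo p zero _ = inj₂ λ _ _ lt le → contradiction (≤-trans lt le) n≮0
    descent-or-sortedUpTo {f} p (suc m) m<n with descent-or-sortedUpTo p m (<⇒≤ m<n)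
    ... | inj₁ des = inj₁ des
    ... | inj₂ sorted with m ≟ 0
    -- Values are positive: no cell carries the value 0, and no two values `f c < f d` are at most
    -- 1.
    ... | yes refl = inj₂ λ c∈ _ lt le → contradiction (≤-trans lt le) (≤⇒≯ (proj₁ (bij-range p c∈)))
    ... | no m≢0 with bij-surjective p (n≢0⇒n>0 m≢0) (<⇒≤ m<n) | bij-surjective p (s≤s z≤n) m<n
    ... | b , b∈ , fb | e , e∈ , fe with b ◁? e
    ... | no ¬b◁e = inj₁ (b , e , b∈ , e∈ , trans fe (cong suc (sym fb)) , e◁b)
      where
      e◁b : e ◁ b
      e◁b with ◁-total {e} {b} (λ { refl → 1+n≢n (trans (sym fe) fb) })
      ... | inj₁ lt = lt
      ... | inj₂ lt = contradiction lt ¬b◁e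
    ... | yes b◁e = inj₂ sorted′
      where
      below-e : ∀ {c} → c ∈ D → f c ≤ m → c ◁ e
      below-e {c} c∈ le with f c ≟ m
      ... | yes eq rewrite bij-injective p c∈ b∈ (trans eq (sym fb)) = b◁e
      ... | no neq = ◁-trans (sorted c∈ b∈ (subst (f c <_) (sym fb) (≤∧≢⇒< le neq)) (≤-reflexive fb)) b◁e
      sorted′ : SortedUpTo f (suc m)
      sorted′ {c} {d} c∈ d∈ lt le with f d ≟ suc m
      ... | yes eq rewrite bij-injective p d∈ e∈ (trans eq (sym fe)) = below-e c∈ (s≤s⁻¹ (subst (f c <_) fe lt))
      ... | no neq = sorted c∈ d∈ lt (s≤s⁻¹ (≤∧≢⇒< le neq))

    -- Both sides are one more than a number of earlier cells, earlier by value on the left and by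
    -- `◁` on the right. For a sorted filling the two notions agree.
    sorted⇒position : ∀ {f} → Bijective f → SortedUpTo f n → ∀ {c} → c ∈ D → f c ≡ position c
    sorted⇒position {f} p sorted {c} c∈ = trans (sym (bij-count p c∈)) (trans (cong suc (sum-cong D λ {e} e∈ →
      χ-cong (f e <? f c) (e ◁? c) (λ lt → sorted e∈ c∈ lt (proj₂ (bij-range p c∈))) (back e∈))) (sym (position-sum c)))
      where
      back : ∀ {e} → e ∈ D → e ◁ c → f e < f c
      back {e} e∈ e◁c = ≤∧≢⇒< (≮⇒≥ λ lt → ◁-irrefl (◁-trans e◁c (sorted c∈ e∈ lt (proj₂ (bij-range p e∈)))))
        λ eq → ◁-irrefl (subst (_◁ c) (bij-injective p e∈ c∈ eq) e◁c)

    descent-or-position : ∀ {f} → Bijective f → Descent f ⊎ (∀ {c} → c ∈ D → f c ≡ position c)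
    descent-or-position p = Sum.map₂ (λ s → sorted⇒position p (λ {c} → s {c})) (descent-or-sortedUpTo p n ≤-refl)

  open ReadingOrder

  -- If `c ⊏ d`, totality leaves `d ◁ c` as the only other case, and it would need one of the two
  -- keys to decrease from `c` to `d`.
  lexicographic : (p q : Cell → ℕ) → (∀ {c d} → p c ≡ p d → q c ≡ q d → c ≡ d) →
    (∀ {c d} → c ⊏ d → p c ≤ p d × q c ≤ q d) → ReadingOrder
  lexicographic p q inj ⊏⇒≤ = record
    { _◁_      = _◁′_
    ; _◁?_     = λ c d → (p c <? p d) ⊎-dec ((p c ≟ p d) ×-dec (q c <? q d))
    ; ◁-irrefl = λ { (inj₁ lt) → <-irrefl refl lt ; (inj₂ (_ , lt)) → <-irrefl refl lt }
    ; ◁-trans  = λ {c} {d} {e} → trans′ {c} {d} {e}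
    ; ◁-total  = total
    ; ⊏⇒◁      = λ c⊏d → ⊏⇒◁′ c⊏d
    }
    where
    _◁′_ : Cell → Cell → Set
    c ◁′ d = p c < p d ⊎ (p c ≡ p d × q c < q d)
    trans′ : ∀ {c d e} → c ◁′ d → d ◁′ e → c ◁′ e
    trans′ (inj₁ l)       (inj₁ m)       = inj₁ (<-trans l m)
    trans′ (inj₁ l)       (inj₂ (e , _)) = inj₁ (<-≤-trans l (≤-reflexive e))
    trans′ (inj₂ (e , _)) (inj₁ m)       = inj₁ (≤-<-trans (≤-reflexive e) m)
    trans′ (inj₂ (e , l)) (inj₂ (f , m)) = inj₂ (trans e f , <-trans l m)
    total : ∀ {c d} → c ≢ d → c ◁′ d ⊎ d ◁′ c
    total {c} {d} c≢d with <-cmp (p c) (p d) | <-cmp (q c) (q d)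
    ... | tri< l _ _ | _          = inj₁ (inj₁ l)
    ... | tri> _ _ l | _          = inj₂ (inj₁ l)
    ... | tri≈ _ e _ | tri< l _ _ = inj₁ (inj₂ (e , l))
    ... | tri≈ _ e _ | tri> _ _ l = inj₂ (inj₂ (sym e , l))
    ... | tri≈ _ e _ | tri≈ _ f _ = contradiction (inj e f) c≢d
    ⊏⇒◁′ : ∀ {c d} → c ⊏ d → c ◁′ d
    ⊏⇒◁′ {c} {d} c⊏d@(_ , _ , c≢d) with total c≢d | ⊏⇒≤ c⊏d
    ... | inj₁ lt             | _       = lt
    ... | inj₂ (inj₁ lt)      | le , _  = contradiction lt (≤⇒≯ le)
    ... | inj₂ (inj₂ (_ , lt)) | _ , le = contradiction lt (≤⇒≯ le)

  -- The decision procedure of a lexicographic order computes to the test used by Srow and Scol, so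
  -- tab α β (position rowOrder) is Srow α β by definition, and likewise for columns.
  rowOrder colOrder : ReadingOrder
  rowOrder = lexicographic row col (cong₂ _,_) λ (r , c , _) → r , c
  colOrder = lexicographic col row (λ e f → cong₂ _,_ f e) λ (r , c , _) → c , r

  -- Inversions

  inverted? : (f : Cell → ℕ) → ∀ c d → Dec (row c < row d × f d < f c)
  inverted? f c d = (row c <? row d) ×-dec (f d <? f c)

  -- For a filling with increasing rows this is the inversion number of its row reading word, that
  -- is, the length of that permutation.
  inv : (Cell → ℕ) → ℕ
  inv f = sum (map (λ d → sum (map (λ c → χ (inverted? f c d)) D)) D)

  inv-cong : ∀ {f g} → (∀ {c} → c ∈ D → f c ≡ g c) → inv f ≡ inv g
  inv-cong {f} {g} eq = sum-cong D λ {d} d∈ → sum-cong D λ {c} c∈ →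
    χ-cong (inverted? f c d) (inverted? g c d)
      (λ (r , lt) → r , subst₂ _<_ (eq d∈) (eq c∈) lt)
      (λ (r , lt) → r , subst₂ _<_ (sym (eq d∈)) (sym (eq c∈)) lt)

  -- The pair with `b` as lower and `a` as higher cell is inverted before the swap and not after it.
  -- All other pairs keep their status.
  inv-swap : ∀ {f a b i} → Bijective f → a ∈ D → b ∈ D → f a ≡ i → f b ≡ suc i → row b < row a →
    inv f ≡ suc (inv (swapVal i ∘ f))
  inv-swap {f} {a} {b} {i} p a∈ b∈ fa fb b<a =
    sum-suc-at cells-unique a∈
      (sum-suc-at cells-unique b∈
        (trans (χ-yes (inverted? f b a) (b<a , ≤-reflexive (trans (cong suc fa) (sym fb))))
               (cong suc (sym (χ-no (inverted? g b a) λ (_ , lt) → <-asym lt gb<ga))))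
        λ c∈ c≢b → unchanged c∈ a∈ λ (c≡b , _) → c≢b c≡b)
      λ d∈ d≢a → sum-cong D λ c∈ → unchanged c∈ d∈ λ (_ , d≡a) → d≢a d≡a
    where
    g : Cell → ℕ
    g = swapVal i ∘ f
    ga : g a ≡ suc i
    ga = trans (cong (swapVal i) fa) (swapVal-fst i)
    gb : g b ≡ i
    gb = trans (cong (swapVal i) fb) (swapVal-snd i)
    gb<ga : g b < g a
    gb<ga = ≤-reflexive (trans (cong suc gb) (sym ga))
    unchanged : ∀ {c d} → c ∈ D → d ∈ D → ¬ (c ≡ b × d ≡ a) → χ (inverted? f c d) ≡ χ (inverted? g c d)
    unchanged {c} {d} c∈ d∈ ¬ba = χ-cong (inverted? f c d) (inverted? g c d)
      (λ (r , lt) → r , swapVal-mono-< lt λ (fd , fc) → ¬ba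
        (bij-injective p c∈ b∈ (trans fc (sym fb)) , bij-injective p d∈ a∈ (trans fd (sym fa))))
      -- Swapping again restores `f`. The pair that this second swap would reverse has `a` as its
      -- lower cell and `b` as its higher one, against `row b < row a`.
      (λ (r , lt) → r , subst₂ _<_ (swapVal-involutive i (f d)) (swapVal-involutive i (f c))
        (swapVal-mono-< lt λ (gd , gc) → <-asym b<a (subst₂ (λ c d → row c < row d)
          (swap-injective i p c∈ a∈ (trans gc (sym ga))) (swap-injective i p d∈ b∈ (trans gd (sym gb))) r)))

  inv-rowOrder : inv (position rowOrder) ≡ 0
  inv-rowOrder = sum-zero D λ {d} _ → sum-zero D λ {c} c∈ → χ-no (inverted? (position rowOrder) c d)
    λ (r , lt) → <-asym lt (position-< rowOrder {c} {d} c∈ (inj₁ r))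

  -- If a linear extension inverts a pair, the lower cell cannot be weakly left of the higher one,
  -- so it is strictly to its right. Column reading inverts every such pair.
  inv-≤-colOrder : ∀ {f} → LinearExtension f → inv f ≤ inv (position colOrder)
  inv-≤-colOrder {f} L = sum-mono D λ {d} d∈ → sum-mono D λ {c} c∈ →
    χ-mono (inverted? f c d) (inverted? (position colOrder) c d) λ (r , lt) → r ,
      position-< colOrder {d} {c} d∈ (inj₁ (≰⇒> λ le →
        <-asym lt (mono L c∈ d∈ (<⇒≤ r , le , λ { refl → <-irrefl refl r }))))

  -- Left shadows and the number of pairs of cells

  sum-rowOrder : sum (map (λ d → sum (map (λ c → χ (_◁?_ rowOrder c d)) D)) D) ≡ n C 2
  sum-rowOrder = begin
    sum (map (λ d → sum (map (λ c → χ (_◁?_ rowOrder c d)) D)) D)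
      ≡⟨ sum-cong D (λ {d} _ → cong (_∸ 1) (sym (position-sum rowOrder d))) ⟩
    sum (map (λ d → position rowOrder d ∸ 1) D)
      -- The positions are 1, ..., `n`, so the numbers of earlier cells are 0, ..., `n ∸ 1`.
      ≡⟨ sum-bij (bij (position-linearExtension rowOrder)) (_∸ 1) ⟩
    sum (map id (upTo n)) ≡⟨ cong sum (map-id (upTo n)) ⟩
    sum (upTo n)          ≡⟨ sum-upTo n ⟩
    n C 2                 ∎
    where open ≡-Reasoning

  weaklySW? : ∀ c d → Dec (row c ≤ row d × col c ≤ col d × ¬ (row c ≡ row d × col c ≡ col d))
  weaklySW? c d = (row c ≤? row d) ×-dec (col c ≤? col d) ×-dec ¬? ((row c ≟ row d) ×-dec (col c ≟ col d))

  -- A pair c ◁ d in row order is either weakly southwest or inverted by Scol, and there are n C 2 of them.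
  totalLs+inv : totalLs α β + inv (position colOrder) ≡ n C 2
  totalLs+inv = trans (sym (trans
    (sum-cong D λ {d} d∈ → trans
      (sum-cong D λ {c} c∈ → χ-⊎ (_◁?_ rowOrder c d) (weaklySW? c d) (inverted? (position colOrder) c d)
        (split c∈ d∈) (λ sw → ⊏⇒◁ rowOrder (sw⇒⊏ sw)) (λ (r , _) → inj₁ r)
        (λ sw (_ , lt) → <-asym lt (mono (position-linearExtension colOrder) c∈ d∈ (sw⇒⊏ sw))))
      (trans (sum-map-+ _ _ D) (cong (_+ sum (map (λ c → χ (inverted? (position colOrder) c d)) D))
        (sym (length-filterᵇ _ D)))))
    (sum-map-+ _ _ D))) sum-rowOrder
    where
    sw⇒⊏ : ∀ {c d} → row c ≤ row d × col c ≤ col d × ¬ (row c ≡ row d × col c ≡ col d) → c ⊏ d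
    sw⇒⊏ (r , k , neq) = r , k , λ { refl → neq (refl , refl) }
    split : ∀ {c d} → c ∈ D → d ∈ D → row c < row d ⊎ (row c ≡ row d × col c < col d) →
      (row c ≤ row d × col c ≤ col d × ¬ (row c ≡ row d × col c ≡ col d)) ⊎
      (row c < row d × position colOrder d < position colOrder c)
    split c∈ d∈ (inj₂ (e , lt)) = inj₁ (≤-reflexive e , <⇒≤ lt , λ (_ , k) → <⇒≢ lt k)
    split {c} {d} c∈ d∈ (inj₁ lt) with col c ≤? col d
    ... | yes le = inj₁ (<⇒≤ lt , le , λ (e , _) → <⇒≢ lt e)
    ... | no nle = inj₂ (lt , position-< colOrder {d} {c} d∈ (inj₁ (≰⇒> nle)))

  rank≡inv : n C 2 ∸ totalLs α β ≡ inv (position colOrder)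
  rank≡inv = trans (cong (_∸ totalLs α β) (sym totalLs+inv)) (m+n∸m≡n (totalLs α β) _)

  -- Tableaux as functions on cells

  rowEntries : ∀ (f : Cell → ℕ) i → map f (rowCells α β i) ≡ applyUpTo (λ k → f (i , suc (part β i + k))) (part α i ∸ part β i)
  rowEntries f i = trans (sym (map-∘ (upTo (part α i ∸ part β i)))) (map-upTo _ _)

  tab-applyUpTo : ∀ f → tab α β f ≡ applyUpTo (λ i → map f (rowCells α β i)) (length α)
  tab-applyUpTo f = map-upTo _ (length α)

  concat-tab : ∀ f → concat (tab α β f) ≡ map f D
  concat-tab f = trans (cong concat (map-∘ (upTo (length α)))) (concat-map (map (rowCells α β) (upTo (length α))))

  tab-cong : ∀ {f g} → (∀ {c} → c ∈ D → f c ≡ g c) → tab α β f ≡ tab α β g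
  tab-cong {f} {g} eq = map-cong (λ i → map-cong-local (All.tabulate λ c∈ → eq (row⊆D i c∈))) (upTo (length α))
    where
    row⊆D : ∀ i {c} → c ∈ rowCells α β i → c ∈ D
    row⊆D i c∈ with refl , p ← ∈-rowCells⁻ {i} c∈ = ∈-cells⁺ p

  tab-injective : ∀ {f g} → tab α β f ≡ tab α β g → ∀ {c} → c ∈ D → f c ≡ g c
  tab-injective {f} {g} eq = map-≡⇒on (trans (sym (concat-tab f)) (trans (cong concat eq) (concat-tab g)))

  swapT-tab : ∀ i f → swapT i (tab α β f) ≡ tab α β (swapVal i ∘ f)
  swapT-tab i f = trans (sym (map-∘ (upTo (length α)))) (map-cong (λ r → sym (map-∘ (rowCells α β r))) (upTo (length α)))

  rowOfT-tab : ∀ f i → rowOfT (tab α β f) i ≡ applyUpTo (λ k → f (i , suc (part β i + k))) (part α i ∸ part β i)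
  rowOfT-tab f i = trans (cong (λ T → rowOfT T i) (tab-applyUpTo f)) lookupRow
    where
    lookupRow : rowOfT (applyUpTo (λ i → map f (rowCells α β i)) (length α)) i ≡
      applyUpTo (λ k → f (i , suc (part β i + k))) (part α i ∸ part β i)
    lookupRow with i <? length α
    ... | yes i<m = trans (cong (fromMaybe []) (nth-applyUpTo _ i<m)) (rowEntries f i)
    -- Above the top row the lookup falls back to the empty list, which agrees with `part α i` being
    -- 0 there.
    ... | no i≮m  = trans (cong (fromMaybe []) (nth-applyUpTo-≥ _ (≮⇒≥ i≮m)))
      (cong (applyUpTo _) (sym (trans (cong (_∸ part β i) (part-outside α (≮⇒≥ i≮m))) (0∸n≡0 (part β i)))))

  entryAt-tab⁺ : ∀ f {i j} → InRow α β i j → entryAt β (tab α β f) i j ≡ just (f (i , j))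
  entryAt-tab⁺ f {i} {j} p rewrite dec-true (part β i <? j) (proj₁ p) | rowOfT-tab f i =
    trans (nth-applyUpTo _ (offset-< p)) (cong (λ j → just (f (i , j))) (offset-+ p))

  entryAt-tab⁻ : ∀ f {i j x} → entryAt β (tab α β f) i j ≡ just x → InRow α β i j × x ≡ f (i , j)
  entryAt-tab⁻ f {i} {j} eq with part β i <? j
  ... | no β≮j rewrite dec-false (part β i <? j) β≮j with () ← eq
  ... | yes β<j with j ≤? part α i
  ... | yes j≤α = (β<j , j≤α) , just-injective (trans (sym eq) (entryAt-tab⁺ f (β<j , j≤α)))
  ... | no j≰α rewrite dec-true (part β i <? j) β<j | rowOfT-tab f i
    with () ← trans (sym eq) (nth-applyUpTo-≥ (λ k → f (i , suc (part β i + k)))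
           (≤-trans (∸-monoˡ-≤ (suc (part β i)) (≰⇒> j≰α)) ≤-refl))

  -- Inverse to `tab α β` on tableaux of the right shape. For these, the default 0 does not occur at
  -- cells of the diagram.
  val : Tableau → Cell → ℕ
  val T (i , j) = fromMaybe 0 (entryAt β T i j)

  tab-val : ∀ {T} → Shaped α β T → tab α β (val T) ≡ T
  tab-val {T} sh = begin
    tab α β (val T)                                            ≡⟨ tab-applyUpTo (val T) ⟩
    applyUpTo (λ i → map (val T) (rowCells α β i)) (length α)  ≡⟨ applyUpTo-cong (length α) eachRow ⟩
    applyUpTo (rowOfT T) (length α)                            ≡⟨ cong (applyUpTo (rowOfT T)) (sym lengthT) ⟩
    applyUpTo (rowOfT T) (length T)                            ≡⟨ applyUpTo-nth [] T ⟩
    T                                                          ∎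
    where
    open ≡-Reasoning
    lengthT : length T ≡ length α
    lengthT = trans (sym (length-map length T)) (trans (cong length sh)
      (trans (length-map _ (upTo (length α))) (length-upTo (length α))))
    lengthRow : ∀ {i} → i < length α → length (rowOfT T i) ≡ part α i ∸ part β i
    lengthRow {i} i<m = trans (length-nth T i) (trans
      (cong (λ l → fromMaybe 0 (nth l i)) (trans sh (map-upTo _ (length α))))
      (cong (fromMaybe 0) (nth-applyUpTo _ i<m)))
    eachRow : ∀ {i} → i < length α → map (val T) (rowCells α β i) ≡ rowOfT T i
    eachRow {i} i<m = trans (rowEntries (val T) i) (trans
      (applyUpTo-cong (part α i ∸ part β i) λ {k} _ → cell k)
      (trans (cong (applyUpTo _) (sym (lengthRow i<m))) (applyUpTo-nth 0 (rowOfT T i))))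
      where
      cell : ∀ k → val T (i , suc (part β i + k)) ≡ fromMaybe 0 (nth (rowOfT T i) k)
      cell k rewrite dec-true (part β i <? suc (part β i + k)) (s≤s (m≤m+n _ k)) | offset-∸ i k = refl

  -- Standard extended tableaux as linear extensions

  linearExtension⇒SET : ∀ {f} → LinearExtension f → IsSET α β (tab α β f)
  linearExtension⇒SET {f} L = (shaped , subst (_↭ map suc (upTo n)) (sym (concat-tab f)) (bij L) , rows , columns 1) , columns
    where
    shaped : Shaped α β (tab α β f)
    shaped = trans (sym (map-∘ (upTo (length α))))
      (map-cong (λ i → trans (length-map f (rowCells α β i)) (length-rowCells i)) (upTo (length α)))
    rows : All (Linked _<_) (tab α β f)
    rows = All.map⁺ (All.universal (λ i → subst (Linked _<_) (sym (rowEntries f i)) (Linked.applyUpTo⁺₁ _ _ λ {k} k< →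
      mono L (∈-cells⁺ (offset-InRow (<-trans (n<1+n k) k<))) (∈-cells⁺ (offset-InRow k<))
        (≤-refl , s≤s (+-monoʳ-≤ (part β i) (n≤1+n k)) ,
         λ e → 1+n≢n (sym (+-cancelˡ-≡ (part β i) _ _ (suc-injective (cong proj₂ e))))))) (upTo (length α)))
    columns : ∀ j → ColInc β (tab α β f) j
    columns j i i′ x y i<i′ ex ey with entryAt-tab⁻ f {i} {j} ex | entryAt-tab⁻ f {i′} {j} ey
    ... | p , refl | q , refl = mono L (∈-cells⁺ p) (∈-cells⁺ q) (<⇒≤ i<i′ , ≤-refl , λ e → <⇒≢ i<i′ (cong proj₁ e))

  module _ (conn : Connected α β) {f : Cell → ℕ}
    (rowMono : ∀ {i j j′} → InRow α β i j → InRow α β i j′ → j < j′ → f (i , j) < f (i , j′))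
    (colMono : ∀ {i i′ j} → InRow α β i j → InRow α β i′ j → i < i′ → f (i , j) < f (i′ , j)) where

    rowMono-≤ : ∀ {i j j′} → InRow α β i j → InRow α β i j′ → j ≤ j′ → f (i , j) ≤ f (i , j′)
    rowMono-≤ p q j≤j′ with m≤n⇒m<n∨m≡n j≤j′
    ... | inj₁ lt   = <⇒≤ (rowMono p q lt)
    ... | inj₂ refl = ≤-refl

    colMono-≤ : ∀ {i i′ j} → InRow α β i j → InRow α β i′ j → i ≤ i′ → f (i , j) ≤ f (i′ , j)
    colMono-≤ p q i≤i′ with m≤n⇒m<n∨m≡n i≤i′
    ... | inj₁ lt   = <⇒≤ (colMono p q lt)
    ... | inj₂ refl = ≤-refl

    ∈-nonemptyRows : ∀ {i j} → InRow α β i j → i ∈ nonemptyRows α β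
    ∈-nonemptyRows {i} p@(β<j , j≤α) = ∈-filter⁺ (λ i → T? (part β i <ᵇ part α i)) (∈-upTo⁺ (InRow⇒<length p))
      (<⇒<ᵇ (<-≤-trans β<j j≤α))

    -- Row s need not meet column c, and neither need the rows in between.  What can be carried from row
    -- to row is that each column from c to the end of the current row u has a cell, weakly below row u,
    -- with an entry no smaller than that of (r , c).
    sw-mono : ∀ {r s c d} → InRow α β r c → InRow α β s d → r ≤ s → c ≤ d → f (r , c) ≤ f (s , d)
    sw-mono {r} {s} {c} {d} p q r≤s c≤d with linked-propagate {J = Dominates} step conn
        (AllPairs.filter⁺ (λ i → T? (part β i <ᵇ part α i)) (AllPairs.applyUpTo⁺₁ id (length α) λ i<j _ → i<j))
        (∈-nonemptyRows p) (∈-nonemptyRows q) (≤⇒≯ r≤s) base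
      where
      Dominates : ℕ → Set
      Dominates u = r ≤ u × ∀ y → c ≤ y → y ≤ part α u → ∃[ v ] v ≤ u × InRow α β v y × f (r , c) ≤ f (v , y)
      base : Dominates r
      base = ≤-refl , λ y c≤y y≤α → let py = <-≤-trans (proj₁ p) c≤y , y≤α in r , ≤-refl , py , rowMono-≤ p py c≤y
      step : ∀ {u w} → u < w → (Σ ℕ λ j → InRow α β u j × InRow α β w j) → Dominates u → Dominates w
      step {u} {w} u<w (j , (_ , j≤u) , (w<j , j≤w)) (r≤u , dom) = ≤-trans r≤u (<⇒≤ u<w) , dom′
        where
        dom′ : ∀ y → c ≤ y → y ≤ part α w → ∃[ v ] v ≤ w × InRow α β v y × f (r , c) ≤ f (v , y)
        dom′ y c≤y y≤w with y ≤? part α u | c ≤? j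
        ... | yes y≤u | _ = let v , v≤u , pv , le = dom y c≤y y≤u in v , ≤-trans v≤u (<⇒≤ u<w) , pv , le
        -- Column `y` lies beyond the end of row `u`: climb to row `w` in the shared column `j`,
        -- then go right to `y`.
        ... | no y≰u | yes c≤j =
          let v , v≤u , pv , le = dom j c≤j j≤u
              j<y = ≤-<-trans j≤u (≰⇒> y≰u)
              py = <-trans w<j j<y , y≤w
          in w , ≤-refl , py , ≤-trans le (≤-trans (colMono-≤ pv (w<j , j≤w) (≤-trans v≤u (<⇒≤ u<w)))
                                                   (rowMono-≤ (w<j , j≤w) py (<⇒≤ j<y)))
        -- The shared column lies left of `c`, so row `w` has a cell in column `c` itself: climb
        -- there directly from `(r , c)`, then go right.
        ... | no y≰u | no c≰j =
          let pc = <-trans w<j (≰⇒> c≰j) , ≤-trans c≤y y≤w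
              py = <-≤-trans (proj₁ pc) c≤y , y≤w
          in w , ≤-refl , py , ≤-trans (colMono-≤ p pc (≤-trans r≤u (<⇒≤ u<w))) (rowMono-≤ pc py c≤y)
    -- In column `d` the witness lies weakly below row `s`, and the column increases up to
    -- `(s , d)`.
    ... | _ , dom with dom d c≤d (proj₂ q)
    ... | v , v≤s , pv , le = ≤-trans le (colMono-≤ pv q v≤s)

  abstract

    -- Rows and columns increase by definition, `sw-mono` extends this weakly to all of `⊏`, and
    -- injectivity makes it strict.
    SET⇒linearExtension : Connected α β → ∀ {T} → IsSET α β T → Σ (Cell → ℕ) λ f → T ≡ tab α β f × LinearExtension f
    SET⇒linearExtension conn {T} ((sh , perm , rows , _) , columns) = f , sym T≡ , record
      { bij  = p
      ; mono = λ c∈ d∈ (r , k , c≢d) → ≤∧≢⇒< (sw-mono conn rowMono colMono (∈-cells⁻ c∈) (∈-cells⁻ d∈) r k)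
                                              (c≢d ∘ bij-injective p c∈ d∈)
      }
      where
      f : Cell → ℕ
      f = val T
      T≡ : tab α β f ≡ T
      T≡ = tab-val sh
      p : Bijective f
      p = subst (_↭ map suc (upTo n)) (trans (cong concat (sym T≡)) (concat-tab f)) perm
      rowLinked : ∀ {i} → i < length α → Linked _<_ (applyUpTo (λ k → f (i , suc (part β i + k))) (part α i ∸ part β i))
      rowLinked {i} i<m = subst (Linked _<_) (rowEntries f i)
        (All.lookup (All.map⁻ (subst (All (Linked _<_)) (sym T≡) rows)) (∈-upTo⁺ i<m))
      rowMono : ∀ {i j j′} → InRow α β i j → InRow α β i j′ → j < j′ → f (i , j) < f (i , j′)
      rowMono {i} {j} {j′} q q′ j<j′ = subst₂ (λ j j′ → f (i , j) < f (i , j′)) (offset-+ q) (offset-+ q′)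
        (allPairs-applyUpTo⁻ _ _ (Linked.Linked⇒AllPairs <-trans (rowLinked (InRow⇒<length q)))
          (∸-monoˡ-< j<j′ (proj₁ q)) (offset-< q′))
      colMono : ∀ {i i′ j} → InRow α β i j → InRow α β i′ j → i < i′ → f (i , j) < f (i′ , j)
      colMono {i} {i′} {j} q q′ i<i′ = columns j i i′ _ _ i<i′ (entry q) (entry q′)
        where
        entry : ∀ {i} → InRow α β i j → entryAt β T i j ≡ just (f (i , j))
        entry {i} q = trans (cong (λ T → entryAt β T i j) (sym T≡)) (entryAt-tab⁺ f q)

  -- The operators on linear extensions

  rowOf-tab : ∀ {f c k} → Bijective f → c ∈ D → f c ≡ k → rowOf k (tab α β f) ≡ just (row c)
  rowOf-tab {f} {c} p c∈ refl = trans (cong (rowOf (f c)) (tab-applyUpTo f))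
    (rowOf-applyUpTo (length α) _ (InRow⇒<length (∈-cells⁻ c∈)) (∈-map⁺ f (∈-rowCells⁺ (∈-cells⁻ c∈))) earlier)
    where
    -- `rowOf` reports the first row that contains the value, so injectivity must exclude the rows
    -- below.
    earlier : ∀ {i} → i < row c → f c ∉ map f (rowCells α β i)
    earlier {i} i<r m with d , d∈ , eq ← ∈-map⁻ f m with refl , q ← ∈-rowCells⁻ {i} d∈ =
      <⇒≢ i<r (cong row (sym (bij-injective p c∈ (∈-cells⁺ q) eq)))

  π-tab : ∀ {f a b i} → Bijective f → a ∈ D → b ∈ D → f a ≡ i → f b ≡ suc i →
    π i (tab α β f) ≡ (if row a <ᵇ row b then just (tab α β f) else
                       (if row b <ᵇ row a then just (tab α β (swapVal i ∘ f)) else nothing))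
  π-tab {f} {i = i} p a∈ b∈ fa fb
    rewrite rowOf-tab p a∈ fa | rowOf-tab p b∈ fb | swapT-tab i f = refl

  -- A proper move has `suc i` strictly lower than `i`, so the cell of `i` is not southwest of that
  -- of `suc i`: `swap-linearExtension` and `inv-swap` apply.
  step-linearExtension : ∀ {f T} → LinearExtension f → Step n (tab α β f) T →
    T ≡ tab α β f ⊎ (Σ (Cell → ℕ) λ g → T ≡ tab α β g × LinearExtension g × inv g < inv f)
  step-linearExtension {f} L (i , 1≤i , i<n , eq)
    with a , a∈ , fa ← bij-surjective (bij L) 1≤i (<⇒≤ i<n)
       | b , b∈ , fb ← bij-surjective (bij L) (s≤s z≤n) i<n
    rewrite π-tab (bij L) a∈ b∈ fa fb with row a <? row b
  ... | yes a<b rewrite dec-true (row a <? row b) a<b = inj₁ (sym (just-injective eq))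
  ... | no a≮b rewrite dec-false (row a <? row b) a≮b with row b <? row a
  ... | yes b<a rewrite dec-true (row b <? row a) b<a = inj₂ (_ , sym (just-injective eq) ,
          swap-linearExtension L a∈ b∈ fa fb (λ (r , _) → <⇒≱ b<a r) ,
          ≤-reflexive (sym (inv-swap (bij L) a∈ b∈ fa fb b<a)))
  ... | no b≮a rewrite dec-false (row b <? row a) b≮a with () ← eq

  -- A path may contain steps that fix the tableau. If all do, its ends coincide; otherwise a proper
  -- move has lowered `inv`, which never rises again.
  ≼-linearExtension : ∀ {S T f} → S ≼[ n ] T → S ≡ tab α β f → LinearExtension f →
    Σ (Cell → ℕ) λ g → T ≡ tab α β g × LinearExtension g × (S ≡ T ⊎ inv g < inv f)
  ≼-linearExtension {f = f} ε refl L = f , refl , L , inj₁ refl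
  ≼-linearExtension (st ◅ sts) refl L with step-linearExtension L st
  ... | inj₁ refl = ≼-linearExtension sts refl L
  ... | inj₂ (g , refl , L′ , lt) with ≼-linearExtension sts refl L′
  ... | h , eq , L″ , inj₁ refl = g , refl , L′ , inj₂ lt
  ... | h , eq , L″ , inj₂ lt′  = h , eq , L″ , inj₂ (<-trans lt′ lt)

  step-swap : ∀ {f a b i} → Bijective f → a ∈ D → b ∈ D → f a ≡ i → f b ≡ suc i → row b < row a →
    Step n (tab α β f) (tab α β (swapVal i ∘ f))
  step-swap {f} {a} {b} {i} p a∈ b∈ fa fb b<a = i ,
    subst (1 ≤_) fa (proj₁ (bij-range p a∈)) , subst (_≤ n) fb (proj₂ (bij-range p b∈)) , moves
    where
    moves : π i (tab α β f) ≡ just (tab α β (swapVal i ∘ f))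
    moves rewrite π-tab p a∈ b∈ fa fb | dec-false (row a <? row b) (<-asym b<a) | dec-true (row b <? row a) b<a = refl

  -- Moves towards the row and the column tableau

  ascend : ∀ {f} → LinearExtension f →
    (Σ (Cell → ℕ) λ g → LinearExtension g × Step n (tab α β f) (tab α β g) × inv f ≡ suc (inv g)) ⊎
    (∀ {c} → c ∈ D → f c ≡ position rowOrder c)
  ascend {f} L with descent-or-position rowOrder (bij L)
  ... | inj₂ eq = inj₂ eq
  ... | inj₁ (a , b , a∈ , b∈ , fb , b◁a) =
    inj₁ (swapVal (f a) ∘ f , swap-linearExtension L a∈ b∈ refl fb (λ (r , _) → <⇒≱ b<a r) ,
      step-swap (bij L) a∈ b∈ refl fb b<a , inv-swap (bij L) a∈ b∈ refl fb b<a)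
    where
    -- Rows increase, so a descent never lies within one row: `b` is strictly lower, as the operator
    -- requires.
    lower : _◁_ rowOrder b a → row b < row a
    lower (inj₁ lt)       = lt
    lower (inj₂ (e , lt)) = contradiction
      (mono L b∈ a∈ (≤-reflexive e , <⇒≤ lt , λ { refl → <-irrefl refl lt }))
      (<-asym (≤-reflexive (sym fb)))
    b<a : row b < row a
    b<a = lower b◁a

  -- At a descent for column order, `b` is strictly left of `a` but has the larger entry; since
  -- `b ⊏ a` is impossible, `b` is strictly higher. After the exchange the operator can move back
  -- up.
  descend : ∀ {f} → LinearExtension f →
    (Σ (Cell → ℕ) λ g → LinearExtension g × Step n (tab α β g) (tab α β f) × inv g ≡ suc (inv f)) ⊎
    (∀ {c} → c ∈ D → f c ≡ position colOrder c)
  descend {f} L with descent-or-position colOrder (bij L)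
  ... | inj₂ eq = inj₂ eq
  ... | inj₁ (a , b , a∈ , b∈ , fb , b◁a) = inj₁ (g , L′ ,
      -- The move up from `g` repeats the same swap and so gives back `f`.
      subst (Step n (tab α β g)) (tab-cong undo) (step-swap (bij L′) b∈ a∈ gb ga a<b) ,
      trans (inv-swap (bij L′) b∈ a∈ gb ga a<b) (cong suc (inv-cong undo)))
    where
    ¬b⊏a : ¬ (b ⊏ a)
    ¬b⊏a b⊏a = <-asym (mono L b∈ a∈ b⊏a) (≤-reflexive (sym fb))
    further : _◁_ colOrder b a → col b < col a
    further (inj₁ lt)       = lt
    further (inj₂ (e , lt)) = contradiction (<⇒≤ lt , ≤-reflexive e , λ { refl → <-irrefl refl lt }) ¬b⊏a
    b<a : col b < col a
    b<a = further b◁a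
    a<b : row a < row b
    a<b = ≰⇒> λ le → ¬b⊏a (le , <⇒≤ b<a , λ { refl → <-irrefl refl b<a })
    g : Cell → ℕ
    g = swapVal (f a) ∘ f
    L′ : LinearExtension g
    L′ = swap-linearExtension L a∈ b∈ refl fb λ (_ , k , _) → <⇒≱ b<a k
    ga : g a ≡ suc (f a)
    ga = swapVal-fst (f a)
    gb : g b ≡ f a
    gb = trans (cong (swapVal (f a)) fb) (swapVal-snd (f a))
    undo : ∀ {c} → c ∈ D → swapVal (f a) (g c) ≡ f c
    undo {c} _ = swapVal-involutive (f a) (f c)

  -- Saturated paths and chains

  step-≢ : ∀ {f g} → inv f ≡ suc (inv g) → tab α β f ≢ tab α β g
  step-≢ {f} {g} eq t = 1+n≢n (trans (sym eq) (inv-cong (tab-injective {f} {g} t)))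

  -- Each ascent uses up one inversion, and a filling without ascents is `Srow`, which has none;
  -- hence exactly `k` moves. `Ts` omits the starting tableau.
  chainToSrow : ∀ k {f} → LinearExtension f → inv f ≡ k → tab α β f ≼[ n ] Srow α β ×
    (Σ (List Tableau) λ Ts → IsChainSET α β (tab α β f ∷ Ts) × length Ts ≡ k)
  chainToSrow k {f} L eq with ascend L
  chainToSrow zero    L eq | inj₁ (_ , _ , _ , d) = contradiction (trans (sym d) eq) λ ()
  chainToSrow (suc k) L eq | inj₁ (g , L′ , st , d) with chainToSrow k L′ (suc-injective (trans (sym d) eq))
  ... | up , Ts , (sets , links) , len =
    st ◅ up , tab α β g ∷ Ts , (linearExtension⇒SET L ∷ sets , ((st ◅ ε) , step-≢ d) ∷ links) , cong suc len
  chainToSrow k L eq | inj₂ pos = subst (_≼[ n ] Srow α β) (sym (tab-cong pos)) ε ,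
    [] , (linearExtension⇒SET L ∷ [] , [-]) , trans (sym (trans (inv-cong pos) inv-rowOrder)) eq

  -- Here `k` is how far `inv f` falls short of its maximum. At `k = 0` a further move down would
  -- exceed that maximum.
  Scol≼ : ∀ k {f} → LinearExtension f → inv (position colOrder) ≡ k + inv f → Scol α β ≼[ n ] tab α β f
  Scol≼ k {f} L eq with descend L
  ... | inj₂ pos = subst (Scol α β ≼[ n ]_) (sym (tab-cong pos)) ε
  Scol≼ zero    L eq | inj₁ (g , L′ , st , d) =
    contradiction (inv-≤-colOrder L′) (<⇒≱ (≤-reflexive (trans (cong suc eq) (sym d))))
  Scol≼ (suc k) {f} L eq | inj₁ (g , L′ , st , d) =
    Scol≼ k L′ (trans eq (trans (sym (+-suc k (inv f))) (cong (k +_) (sym d)))) ◅◅ (st ◅ ε)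

  -- Each link joins distinct tableaux, so `inv` drops by at least one along it.
  chain-length : ∀ {S f Ts} → S ≡ tab α β f → LinearExtension f →
    Linked (λ S T → S ≼[ n ] T × S ≢ T) (S ∷ Ts) → length (S ∷ Ts) ≤ suc (inv f)
  chain-length _ _ [-] = s≤s z≤n
  chain-length eq L ((S≼T , S≢T) ∷ links) with ≼-linearExtension S≼T eq L
  ... | _ , _   , _  , inj₁ S≡T = contradiction S≡T S≢T
  ... | g , eq′ , L′ , inj₂ lt  = s≤s (≤-trans (chain-length eq′ L′ links) lt)

  -- Minimality, the interval and the rank

  module _ (conn : Connected α β) where

    colExtension : LinearExtension (position colOrder)
    colExtension = position-linearExtension colOrder

    Scol-least : ∀ {T} → IsSET α β T → Scol α β ≼[ n ] T
    Scol-least set with f , refl , L ← SET⇒linearExtension conn set =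
      Scol≼ _ L (sym (m∸n+n≡m (inv-≤-colOrder L)))

    Srow-greatest : ∀ {T} → IsSET α β T → T ≼[ n ] Srow α β
    Srow-greatest set with f , refl , L ← SET⇒linearExtension conn set = proj₁ (chainToSrow _ L refl)

    -- A tableau properly below `Scol` would have more inversions than `Scol`, which has the most.
    Scol-minimal : IsMinimalSET α β (Scol α β)
    Scol-minimal = linearExtension⇒SET colExtension , minimal
      where
      minimal : ∀ S → IsSET α β S → S ≼[ n ] Scol α β → S ≡ Scol α β
      minimal S set S≼ with f , eq , L ← SET⇒linearExtension conn set with ≼-linearExtension S≼ eq L
      ... | _ , _   , _ , inj₁ S≡ = S≡
      ... | g , eq′ , _ , inj₂ lt = contradiction (inv-≤-colOrder L)
        (<⇒≱ (subst (_< inv f) (inv-cong (tab-injective {g} {position colOrder} (sym eq′))) lt))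

    minimal-unique : ∀ T → IsMinimalSET α β T → T ≡ Scol α β
    minimal-unique T (set , minimal) = sym (minimal _ (proj₁ Scol-minimal) (Scol-least set))

    interval : ∀ T → IsSET α β T ⇔ (IsSIT α β T × Scol α β ≼[ n ] T × T ≼[ n ] Srow α β)
    interval T = mk⇔ (λ set → proj₁ set , Scol-least set , Srow-greatest set) back
      where
      back : IsSIT α β T × Scol α β ≼[ n ] T × T ≼[ n ] Srow α β → IsSET α β T
      -- The operators send linear extensions to linear extensions, so all that is reachable from
      -- `Scol` is extended.
      back (_ , Scol≼T , _) with g , refl , L , _ ← ≼-linearExtension Scol≼T refl colExtension = linearExtension⇒SET L

    rank : HasRankSET α β (n C 2 ∸ totalLs α β)
    rank rewrite rank≡inv = longest , bound
      where
      longest : Σ (List Tableau) λ Ts → IsChainSET α β Ts × length Ts ≡ suc (inv (position colOrder))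
      -- The climb from `Scol` to `Srow` takes `inv (position colOrder)` moves; `Scol` itself is the
      -- extra element of the chain.
      longest with _ , Ts , chain , len ← chainToSrow _ colExtension refl = Scol α β ∷ Ts , chain , cong suc len
      bound : ∀ Ts → IsChainSET α β Ts → length Ts ≤ suc (inv (position colOrder))
      bound []       _              = z≤n
      bound (S ∷ Ts) (set ∷ _ , links) with f , eq , L ← SET⇒linearExtension conn set =
        ≤-trans (chain-length eq L links) (s≤s (inv-≤-colOrder L))

theorem13 : (α β : List ℕ) → IsComposition α → IsComposition β → β ⊆c α →
    Connected α β →
    (IsMinimalSET α β (Scol α β) ×
    (∀ T → IsMinimalSET α β T → T ≡ Scol α β)) ×
    (∀ T → IsSET α β T ⇔
    (IsSIT α β T × Scol α β ≼[ size α β ] T × T ≼[ size α β ] Srow α β)) ×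
    HasRankSET α β (size α β C 2 ∸ totalLs α β)
theorem13 α β _ _ β⊆α conn = (Scol-minimal conn , minimal-unique conn) , interval conn , rank conn
  where open Diagram α β β⊆α
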